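{- Let $n,k,t,s$ be positive integers with $k\geq t+1$ and $n\geq (t+1)\left(2(k-t+1)^{2}+7s\right)$. Suppose that $\mathcal{F},\mathcal{G}\subseteq \binom{[n]}{k}$ are $s$-almost cross-$t$-intersecting families such that $|\mathcal{F}||\mathcal{G}|$ is maximum among all pairs of $s$-almost cross-$t$-intersecting families in $\binom{[n]}{k}$. Then there exists $W\in\binom{[n]}{t}$ such that $\mathcal{F}=\mathcal{G}=\left\{H\in\binom{[n]}{k}: W\subseteq H\right\}$.
   Context: $[n]=\{1,\dots,n\}$ and $\binom{X}{k}$ denotes the family of all $k$-subsets of a set $X$. Two sets $F,G$ are $t$-intersecting if $|F\cap G|\geq t$ and $t$-disjoint otherwise. Two families $\mathcal{F},\mathcal{G}\subseteq\binom{[n]}{k}$ are $s$-almost cross-$t$-intersecting if each member of $\mathcal{F}$ is $t$-disjoint with at most $s$ members of $\mathcal{G}$, and each member of $\mathcal{G}$ is $t$-disjoint with at most $s$ members of $\mathcal{F}$. -}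

module Defs where

open import Data.Nat using (ℕ; zero; suc; _<_; _≤_; _<?_)
open import Data.Bool using (Bool; true; false; _∧_; T)
open import Data.Fin.Subset using (Subset; ∣_∣; _∩_; outside; inside)
open import Data.List using (List; []; _∷_; map; _++_; filter; length)
open import Data.Vec using (_∷_; [])
open import Data.Product using (_×_)
open import Relation.Nullary.Decidable using (⌊_⌋)
open import Relation.Binary.PropositionalEquality using (_≡_)
open import Data.Bool.Properties using (T?)

allSubsets : (n : ℕ) → List (Subset n)
allSubsets zero = [] ∷ []
allSubsets (suc n) = map (outside ∷_) (allSubsets n) ++ map (inside ∷_) (allSubsets n)

Family : ℕ → Set
Family n = Subset n → Bool

InLayer : {n : ℕ} → ℕ → Family n → Set
InLayer k F = ∀ A → F A ≡ true → ∣ A ∣ ≡ k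

size : {n : ℕ} → Family n → ℕ
size {n} F = length (filter (λ A → T? (F A)) (allSubsets n))

tDisjointᵇ : {n : ℕ} → ℕ → Subset n → Subset n → Bool
tDisjointᵇ t A B = ⌊ ∣ A ∩ B ∣ <? t ⌋

numTDisjoint : {n : ℕ} → ℕ → Family n → Subset n → ℕ
numTDisjoint {n} t G A =
  length (filter (λ B → T? (G B ∧ tDisjointᵇ t A B)) (allSubsets n))

AlmostCrossIntersecting : {n : ℕ} → ℕ → ℕ → Family n → Family n → Set
AlmostCrossIntersecting s t F G =
  (∀ A → F A ≡ true → numTDisjoint t G A ≤ s) ×
  (∀ B → G B ≡ true → numTDisjoint t F B ≤ s)

{-# OPTIONS --safe #-}

-- Put r = k − t, q = r + 1, p = (t + 1) q, and let N d be the number of k-sets containing a given (t + d)-set.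
-- Call S an almost-cover of a family when S is t-disjoint with at most s of its members; each member of 𝓖 is an
-- almost-cover of 𝓕 and vice versa.  Let t + d and t + e be the least sizes (at least t) of almost-covers of 𝓕 and 𝓖.
--
-- If U is not an almost-cover of 𝓖, some B ∈ 𝓖 is t-disjoint with U; all but s members of 𝓕 above U then meet a
-- fixed (r + 1)-subset of B ∖ U.  Iterating e times from each t-subset of a least almost-cover of 𝓕 gives
-- |𝓕| ≤ C(t + d, t) qᵉ (s + N e), hence |𝓕||𝓖| ≤ Q d · Q e with Q d = pᵈ (s + N d).  For large n one has
-- 14 Q 0 ≤ 15 N 0 and 14 Q d ≤ 13 N 0 for d ≥ 1, so |𝓕||𝓖| < (N 0)² unless d = e = 0, whereas a star paired with
-- itself attains (N 0)².
--
-- So there are t-sets T₁, T₂ almost covering 𝓕 and 𝓖.  A member of 𝓖 not containing T₁ would force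
-- |𝓕| ≤ 2s + q N 1, again too small; thus 𝓖 lies in the star of T₁, 𝓕 in that of T₂, and both are equal to these
-- stars by counting.  If T₁ ≠ T₂, then |𝓕| ≤ s + N 1 < N 0.
module Submission where

open import Defs
open import Algebra.Properties.CommutativeSemigroup using (interchange)
open import Data.Bool using (Bool; true; false; _∧_; not)
open import Data.Bool.Properties using (T?; T-≡; ∧-conicalˡ; ∧-conicalʳ)
open import Data.Empty using (⊥)
open import Data.Fin.Subset hiding (⊥)
open import Data.Fin.Subset.Properties
open import Data.List using (List; []; _∷_; map; _++_; filter; length)
open import Data.List.Membership.Propositional using (lose) renaming (_∈_ to _∈ˡ_)
open import Data.List.Membership.Propositional.Properties using (∈-map⁺; ∈-++⁺ˡ; ∈-++⁺ʳ; ∈-filter⁺; ∈-filter⁻)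
open import Data.List.Properties using (filter-++; length-++)
open import Data.List.Relation.Unary.Any using (Any; here; there)
open import Data.Nat
open import Data.Nat.Combinatorics using (_C_; nC1≡n; nCk≡nC[n∸k]; nCk+nC[k+1]≡[n+1]C[k+1])
open import Data.Nat.Properties
open import Data.Nat.Tactic.RingSolver using (solve-∀)
open import Data.Product using (_×_; _,_; proj₁; proj₂; ∃-syntax; ∃)
open import Data.Sum using (_⊎_; inj₁; inj₂; [_,_])
open import Data.Vec as Vec using ([]; _∷_)
open import Function using (_∘_; id)
open import Function.Bundles using (_⇔_; mk⇔; Equivalence)
open import Relation.Binary.PropositionalEquality hiding ([_])
open import Relation.Nullary using (Dec; yes; no; ¬_; contradiction)
open import Relation.Nullary.Decidable using (⌊_⌋; _×-dec_)

private
  variable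
    m n : ℕ

-- Boolean reflection and counting of members of families.

⌊⌋⁺ : ∀ {a} {A : Set a} (a? : Dec A) → A → ⌊ a? ⌋ ≡ true
⌊⌋⁺ (yes _) _ = refl
⌊⌋⁺ (no ¬a) a = contradiction a ¬a

⌊⌋⁻ : ∀ {a} {A : Set a} (a? : Dec A) → ⌊ a? ⌋ ≡ true → A
⌊⌋⁻ (yes a) _ = a

∧⁺ : ∀ {a b} → a ≡ true → b ≡ true → a ∧ b ≡ true
∧⁺ refl refl = refl

infix 4 _⊑_

_⊑_ : Family n → Family n → Set
F ⊑ G = ∀ A → F A ≡ true → G A ≡ true

length-filter-map : ∀ {a b} {A : Set a} {B : Set b} (f : A → B) (P : B → Bool) xs →
  length (filter (λ y → T? (P y)) (map f xs)) ≡ length (filter (λ x → T? (P (f x))) xs)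
length-filter-map f P []       = refl
length-filter-map f P (x ∷ xs) with P (f x)
... | true  = cong suc (length-filter-map f P xs)
... | false = length-filter-map f P xs

size-∷ : (F : Family (suc n)) → size F ≡ size (F ∘ (outside ∷_)) + size (F ∘ (inside ∷_))
size-∷ {n} F = begin
  length (filter F? (map (outside ∷_) S ++ map (inside ∷_) S))
    ≡⟨ cong length (filter-++ F? (map (outside ∷_) S) _) ⟩
  length (filter F? (map (outside ∷_) S) ++ filter F? (map (inside ∷_) S))
    ≡⟨ length-++ (filter F? (map (outside ∷_) S)) ⟩
  length (filter F? (map (outside ∷_) S)) + length (filter F? (map (inside ∷_) S))
    ≡⟨ cong₂ _+_ (half outside) (half inside) ⟩
  size (F ∘ (outside ∷_)) + size (F ∘ (inside ∷_)) ∎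
  where
  open ≡-Reasoning
  S = allSubsets n
  F? = λ A → T? (F A)
  half : ∀ x → length (filter F? (map (x ∷_) S)) ≡ size (F ∘ (x ∷_))
  half x = length-filter-map (x ∷_) F S

size-mono : (F G : Family n) → F ⊑ G → size F ≤ size G
size-mono {zero} F G F⊑G with F [] in F[] | G [] in G[]
... | false | _     = z≤n
... | true  | true  = ≤-refl
... | true  | false = contradiction (trans (sym G[]) (F⊑G [] F[])) λ ()
size-mono {suc n} F G F⊑G = begin
  size F                                            ≡⟨ size-∷ F ⟩
  size (F ∘ (outside ∷_)) + size (F ∘ (inside ∷_))  ≤⟨ +-mono-≤ (size-mono _ _ (F⊑G ∘ (outside ∷_))) (size-mono _ _ (F⊑G ∘ (inside ∷_))) ⟩
  size (G ∘ (outside ∷_)) + size (G ∘ (inside ∷_))  ≡⟨ size-∷ G ⟨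
  size G                                            ∎
  where open ≤-Reasoning

size-cong : (F G : Family n) → F ⊑ G → G ⊑ F → size F ≡ size G
size-cong F G F⊑G G⊑F = ≤-antisym (size-mono F G F⊑G) (size-mono G F G⊑F)

size-∅ : (F : Family n) → (∀ A → F A ≢ true) → size F ≡ 0
size-∅ {zero} F ∅ with F [] in F[]
... | true  = contradiction F[] (∅ [])
... | false = refl
size-∅ {suc n} F ∅ = trans (size-∷ F) (cong₂ _+_ (size-∅ _ (∅ ∘ (outside ∷_))) (size-∅ _ (∅ ∘ (inside ∷_))))

size-∪ : (F G H : Family n) → (∀ A → F A ≡ true → G A ≡ true ⊎ H A ≡ true) → size F ≤ size G + size H
size-∪ {zero} F G H cover with F [] in F[] | G [] in G[] | H [] in H[]
... | false | _     | _     = z≤n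
... | true  | true  | _     = s≤s z≤n
... | true  | false | true  = s≤s z≤n
... | true  | false | false with cover [] F[]
...   | inj₁ p = contradiction (trans (sym G[]) p) λ ()
...   | inj₂ p = contradiction (trans (sym H[]) p) λ ()
size-∪ {suc n} F G H cover = begin
  size F                                      ≡⟨ size-∷ F ⟩
  size (F ∘ (outside ∷_)) + size (F ∘ (inside ∷_)) ≤⟨ +-mono-≤ (half outside) (half inside) ⟩
  (g outside + h outside) + (g inside + h inside) ≡⟨ interchange +-commutativeSemigroup (g outside) (h outside) (g inside) (h inside) ⟩
  (g outside + g inside) + (h outside + h inside) ≡⟨ cong₂ _+_ (size-∷ G) (size-∷ H) ⟨
  size G + size H                             ∎
  where
  open ≤-Reasoning
  g h : Side → ℕ
  g x = size (G ∘ (x ∷_))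
  h x = size (H ∘ (x ∷_))
  half : ∀ x → size (F ∘ (x ∷_)) ≤ g x + h x
  half x = size-∪ _ _ _ (cover ∘ (x ∷_))

-- Each half of `F` is at most the matching half of `G`, so if the totals leave no gap, neither half
-- has one. This later turns inclusion in a star plus a count into equality.
size-≤⇒⊒ : (F G : Family n) → F ⊑ G → size G ≤ size F → G ⊑ F
size-≤⇒⊒ {zero} F G F⊑G G≤F [] G[] with F []
... | true  = refl
... | false rewrite G[] = contradiction G≤F λ ()
size-≤⇒⊒ {suc n} F G F⊑G G≤F (x ∷ A) GA = size-≤⇒⊒ _ _ (F⊑G ∘ (x ∷_)) (half x) A GA
  where
  split : size (G ∘ (outside ∷_)) + size (G ∘ (inside ∷_)) ≤ size (F ∘ (outside ∷_)) + size (F ∘ (inside ∷_))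
  split = subst₂ _≤_ (size-∷ G) (size-∷ F) G≤F
  F≤G : ∀ x → size (F ∘ (x ∷_)) ≤ size (G ∘ (x ∷_))
  F≤G x = size-mono _ _ (F⊑G ∘ (x ∷_))
  half : ∀ x → size (G ∘ (x ∷_)) ≤ size (F ∘ (x ∷_))
  half false = +-cancelʳ-≤ (size (G ∘ (inside ∷_))) _ _ (≤-trans split (+-monoʳ-≤ _ (F≤G inside)))
  half true  = +-cancelˡ-≤ (size (G ∘ (outside ∷_))) _ _ (≤-trans split (+-monoˡ-≤ _ (F≤G outside)))

∈-allSubsets : (A : Subset n) → A ∈ˡ allSubsets n
∈-allSubsets []            = here refl
∈-allSubsets (outside ∷ A) = ∈-++⁺ˡ (∈-map⁺ (outside ∷_) (∈-allSubsets A))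
∈-allSubsets {suc n} (inside ∷ A) = ∈-++⁺ʳ (map (outside ∷_) (allSubsets n)) (∈-map⁺ (inside ∷_) (∈-allSubsets A))

size-positive : (F : Family n) → 0 < size F → ∃[ A ] F A ≡ true
size-positive {n} F 0<F with filter (λ A → T? (F A)) (allSubsets n) in eq
... | A ∷ _ = A , Equivalence.to T-≡ (proj₂ (∈-filter⁻ (λ A → T? (F A)) {xs = allSubsets n} (subst (A ∈ˡ_) (sym eq) (here refl))))

-- Union bound. Members already covered by the head are removed before recursing, so the tail must
-- cover all that remain.
size-⋃ : ∀ {a} {X : Set a} (xs : List X) (F : Family n) (R : X → Family n) (b : ℕ) →
  (∀ A → F A ≡ true → Any (λ x → R x A ≡ true) xs) →
  (∀ {x} → x ∈ˡ xs → size (R x) ≤ b) → size F ≤ length xs * b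
size-⋃ [] F R b cover bound = ≤-reflexive (size-∅ F λ A FA → contradiction (cover A FA) λ ())
size-⋃ (x ∷ xs) F R b cover bound = begin
  size F               ≤⟨ size-∪ F (R x) F′ split ⟩
  size (R x) + size F′ ≤⟨ +-mono-≤ (bound (here refl)) (size-⋃ xs F′ R b cover′ (bound ∘ there)) ⟩
  b + length xs * b    ∎
  where
  open ≤-Reasoning
  F′ = λ A → F A ∧ not (R x A)
  split : ∀ A → F A ≡ true → R x A ≡ true ⊎ F′ A ≡ true
  split A FA with R x A
  ... | true  = inj₁ refl
  ... | false = inj₂ (∧⁺ FA refl)
  cover′ : ∀ A → F′ A ≡ true → Any (λ y → R y A ≡ true) xs
  cover′ A F′A with cover A (∧-conicalˡ (F A) _ F′A)
  ... | there p = p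
  ... | here RxA = contradiction (trans (sym (cong not RxA)) (∧-conicalʳ (F A) _ F′A)) λ ()

size-⋃-family : (K : Family m) (F : Family n) (R : Subset m → Family n) (b : ℕ) →
  (∀ A → F A ≡ true → ∃[ X ] (K X ≡ true × R X A ≡ true)) →
  (∀ X → K X ≡ true → size (R X) ≤ b) → size F ≤ size K * b
size-⋃-family {m} K F R b cover bound = size-⋃ (filter K? (allSubsets m)) F R b cover′ bound′
  where
  K? = λ X → T? (K X)
  cover′ : ∀ A → F A ≡ true → Any (λ X → R X A ≡ true) (filter K? (allSubsets m))
  cover′ A FA with cover A FA
  ... | X , KX , RXA = lose (∈-filter⁺ K? (∈-allSubsets X) (Equivalence.from T-≡ KX)) RXA
  bound′ : ∀ {X} → X ∈ˡ filter K? (allSubsets m) → size (R X) ≤ b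
  bound′ {X} X∈ = bound X (Equivalence.to T-≡ (proj₂ (∈-filter⁻ K? {xs = allSubsets m} X∈)))

-- Subsets of a fixed set, stars, and their binomial counts.

below? : ∀ j (D X : Subset n) → Dec (∣ X ∣ ≡ j × X ⊆ D)
below? j D X = (∣ X ∣ ≟ j) ×-dec (X ⊆? D)

star? : ∀ k (W H : Subset n) → Dec (∣ H ∣ ≡ k × W ⊆ H)
star? k W H = (∣ H ∣ ≟ k) ×-dec (W ⊆? H)

below : ℕ → Subset n → Family n
below j D X = ⌊ below? j D X ⌋

star : ℕ → Subset n → Family n
star k W H = ⌊ star? k W H ⌋

size-≐ : {P Q : Subset m → Set} (P? : ∀ X → Dec (P X)) (Q? : ∀ X → Dec (Q X)) →
  (∀ X → P X → Q X) → (∀ X → Q X → P X) → size (λ X → ⌊ P? X ⌋) ≡ size (λ X → ⌊ Q? X ⌋)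
size-≐ P? Q? to from = size-cong _ _ (λ X → ⌊⌋⁺ (Q? X) ∘ to X ∘ ⌊⌋⁻ (P? X)) (λ X → ⌊⌋⁺ (P? X) ∘ from X ∘ ⌊⌋⁻ (Q? X))

size-below : ∀ j (D : Subset n) → size (below j D) ≡ ∣ D ∣ C j
size-below zero    [] = refl
size-below (suc j) [] = refl
size-below {suc n} j (outside ∷ D) = begin
  size (below j (outside ∷ D)) ≡⟨ size-∷ (below j (outside ∷ D)) ⟩
  _ ≡⟨ cong₂ _+_ (size-≐ (λ X → below? j (outside ∷ D) (outside ∷ X)) (λ X → below? j D X)
                    (λ X (c , p) → c , drop-∷-⊆ p)
                    (λ X (c , p) → c , out⊆ p))
                 (size-∅ (below j (outside ∷ D) ∘ (inside ∷_)) λ X p → contradiction (proj₂ (⌊⌋⁻ (below? j (outside ∷ D) (inside ∷ X)) p) Vec.here) λ ()) ⟩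
  size (below j D) + 0 ≡⟨ +-identityʳ _ ⟩
  size (below j D) ≡⟨ size-below j D ⟩
  ∣ D ∣ C j ∎
  where open ≡-Reasoning
size-below {suc n} zero (inside ∷ D) = begin
  size (below 0 (inside ∷ D)) ≡⟨ size-∷ (below 0 (inside ∷ D)) ⟩
  _ ≡⟨ cong₂ _+_ (size-≐ (λ X → below? 0 (inside ∷ D) (outside ∷ X)) (λ X → below? 0 D X)
                    (λ X (c , p) → c , drop-∷-⊆ p)
                    (λ X (c , p) → c , out⊆ p))
                 (size-∅ (below 0 (inside ∷ D) ∘ (inside ∷_)) λ X p → contradiction (proj₁ (⌊⌋⁻ (below? 0 (inside ∷ D) (inside ∷ X)) p)) λ ()) ⟩
  size (below 0 D) + 0 ≡⟨ +-identityʳ _ ⟩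
  size (below 0 D) ≡⟨ size-below 0 D ⟩
  1 ∎
  where open ≡-Reasoning
size-below {suc n} (suc j) (inside ∷ D) = begin
  size (below (suc j) (inside ∷ D)) ≡⟨ size-∷ (below (suc j) (inside ∷ D)) ⟩
  _ ≡⟨ cong₂ _+_ (size-≐ (λ X → below? (suc j) (inside ∷ D) (outside ∷ X)) (λ X → below? (suc j) D X)
                    (λ X (c , p) → c , drop-∷-⊆ p)
                    (λ X (c , p) → c , out⊆ p))
                 (size-≐ (λ X → below? (suc j) (inside ∷ D) (inside ∷ X)) (λ X → below? j D X)
                    (λ X (c , p) → suc-injective c , drop-∷-⊆ p)
                    (λ X (c , p) → cong suc c , in⊆in p)) ⟩
  size (below (suc j) D) + size (below j D) ≡⟨ cong₂ _+_ (size-below (suc j) D) (size-below j D) ⟩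
  ∣ D ∣ C suc j + ∣ D ∣ C j ≡⟨ +-comm (∣ D ∣ C suc j) _ ⟩
  ∣ D ∣ C j + ∣ D ∣ C suc j ≡⟨ nCk+nC[k+1]≡[n+1]C[k+1] ∣ D ∣ j ⟩
  suc ∣ D ∣ C suc j ∎
  where open ≡-Reasoning

-- Coordinates inside `W` are forced, while each of the `v` coordinates outside it gives one step of
-- Pascal's rule. Writing the layer as `∣ W ∣ + r` lets it shrink together with `W`.
size-star : ∀ v r (W : Subset n) → ∣ W ∣ + v ≡ n → size (star (∣ W ∣ + r) W) ≡ v C r
size-star zero zero    [] _ = refl
size-star zero (suc r) [] _ = refl
size-star {suc n} v r (inside ∷ W) eq = begin
  size (star k (inside ∷ W)) ≡⟨ size-∷ (star k (inside ∷ W)) ⟩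
  _ ≡⟨ cong₂ _+_ (size-∅ (star k (inside ∷ W) ∘ (outside ∷_)) λ H p → contradiction (proj₂ (⌊⌋⁻ (star? k (inside ∷ W) (outside ∷ H)) p) Vec.here) λ ())
                 (size-≐ (λ X → star? k (inside ∷ W) (inside ∷ X)) (λ H → star? (∣ W ∣ + r) W H)
                    (λ X (c , p) → suc-injective c , drop-∷-⊆ p)
                    (λ X (c , p) → cong suc c , in⊆in p)) ⟩
  size (star (∣ W ∣ + r) W) ≡⟨ size-star v r W (suc-injective eq) ⟩
  v C r ∎
  where
  open ≡-Reasoning
  k = suc (∣ W ∣ + r)
-- A coordinate outside `W` is a free element, so `v` cannot be 0.
size-star {suc n} zero r (outside ∷ W) eq = contradiction (≤-trans (≤-reflexive (sym (trans (sym (+-identityʳ ∣ W ∣)) eq))) (∣p∣≤n W)) 1+n≰n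
size-star {suc n} (suc v) zero (outside ∷ W) eq = begin
  size (star k (outside ∷ W)) ≡⟨ size-∷ (star k (outside ∷ W)) ⟩
  _ ≡⟨ cong₂ _+_ (size-≐ (λ X → star? k (outside ∷ W) (outside ∷ X)) (λ H → star? k W H)
                    (λ X (c , p) → c , drop-∷-⊆ p)
                    (λ X (c , p) → c , out⊆ p))
                 (size-∅ (star k (outside ∷ W) ∘ (inside ∷_)) λ H p → let c , q = ⌊⌋⁻ (star? k (outside ∷ W) (inside ∷ H)) p in
                    1+n≰n (≤-trans (≤-reflexive (trans c (+-identityʳ ∣ W ∣))) (p⊆q⇒∣p∣≤∣q∣ {p = W} {q = H} (drop-∷-⊆ q)))) ⟩
  size (star k W) + 0 ≡⟨ +-identityʳ _ ⟩
  size (star k W) ≡⟨ size-star v zero W (suc-injective (trans (sym (+-suc ∣ W ∣ v)) eq)) ⟩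
  1 ∎
  where
  open ≡-Reasoning
  k = ∣ W ∣ + 0
size-star {suc n} (suc v) (suc r) (outside ∷ W) eq = begin
  size (star k (outside ∷ W)) ≡⟨ size-∷ (star k (outside ∷ W)) ⟩
  _ ≡⟨ cong₂ _+_ (size-≐ (λ X → star? k (outside ∷ W) (outside ∷ X)) (λ H → star? k W H)
                    (λ X (c , p) → c , drop-∷-⊆ p)
                    (λ X (c , p) → c , out⊆ p))
                 (size-≐ (λ X → star? k (outside ∷ W) (inside ∷ X)) (λ H → star? (∣ W ∣ + r) W H)
                    (λ X (c , p) → suc-injective (trans c (+-suc ∣ W ∣ r)) , drop-∷-⊆ p)
                    (λ X (c , p) → trans (cong suc c) (sym (+-suc ∣ W ∣ r)) , out⊆ p)) ⟩
  size (star k W) + size (star (∣ W ∣ + r) W) ≡⟨ cong₂ _+_ (size-star v (suc r) W eq′) (size-star v r W eq′) ⟩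
  v C suc r + v C r ≡⟨ +-comm (v C suc r) _ ⟩
  v C r + v C suc r ≡⟨ nCk+nC[k+1]≡[n+1]C[k+1] v r ⟩
  suc v C suc r ∎
  where
  open ≡-Reasoning
  k = ∣ W ∣ + suc r
  eq′ = suc-injective (trans (sym (+-suc ∣ W ∣ v)) eq)

-- Choosing subsets of given size and splitting cardinalities.

⊆-ofSize : ∀ j (D : Subset n) → j ≤ ∣ D ∣ → ∃[ X ] (∣ X ∣ ≡ j × X ⊆ D)
⊆-ofSize {n} zero D _ = Vec.replicate n outside , ∣⊥∣≡0 n , ⊥⊆
⊆-ofSize (suc j) (outside ∷ D) j≤ = let X , c , p = ⊆-ofSize (suc j) D j≤ in outside ∷ X , c , out⊆ p
⊆-ofSize (suc j) (inside  ∷ D) (s≤s j≤) = let X , c , p = ⊆-ofSize j D j≤ in inside ∷ X , cong suc c , in⊆in p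

∣p∩q∣+∣p─q∣≡∣p∣ : (p q : Subset n) → ∣ p ∩ q ∣ + ∣ p ─ q ∣ ≡ ∣ p ∣
∣p∩q∣+∣p─q∣≡∣p∣ [] [] = refl
∣p∩q∣+∣p─q∣≡∣p∣ (outside ∷ p) (outside ∷ q) = ∣p∩q∣+∣p─q∣≡∣p∣ p q
∣p∩q∣+∣p─q∣≡∣p∣ (outside ∷ p) (inside  ∷ q) = ∣p∩q∣+∣p─q∣≡∣p∣ p q
∣p∩q∣+∣p─q∣≡∣p∣ (inside  ∷ p) (outside ∷ q) = trans (+-suc _ _) (cong suc (∣p∩q∣+∣p─q∣≡∣p∣ p q))
∣p∩q∣+∣p─q∣≡∣p∣ (inside  ∷ p) (inside  ∷ q) = cong suc (∣p∩q∣+∣p─q∣≡∣p∣ p q)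

-- Binomial identities and exponential bounds.

-- The absorption identity, from Pascal's rule; it drives all comparisons along a diagonal of
-- Pascal's triangle.
[k+1]*[n+1]C[k+1]≡[n+1]*nCk : ∀ n k → suc k * (suc n C suc k) ≡ suc n * (n C k)
[k+1]*[n+1]C[k+1]≡[n+1]*nCk zero    zero    = refl
[k+1]*[n+1]C[k+1]≡[n+1]*nCk zero    (suc k) = *-zeroʳ k
[k+1]*[n+1]C[k+1]≡[n+1]*nCk (suc n) zero    = trans (*-identityˡ _) (trans (nC1≡n (suc (suc n))) (sym (*-identityʳ _)))
[k+1]*[n+1]C[k+1]≡[n+1]*nCk (suc n) (suc k) = begin
  suc (suc k) * (suc (suc n) C suc (suc k))
    ≡⟨ cong (suc (suc k) *_) (nCk+nC[k+1]≡[n+1]C[k+1] (suc n) (suc k)) ⟨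
  suc (suc k) * (a + b)                                     ≡⟨ *-distribˡ-+ (suc (suc k)) a b ⟩
  (a + suc k * a) + suc (suc k) * b
    ≡⟨ cong₂ (λ x y → (a + x) + y) ([k+1]*[n+1]C[k+1]≡[n+1]*nCk n k) ([k+1]*[n+1]C[k+1]≡[n+1]*nCk n (suc k)) ⟩
  (a + suc n * (n C k)) + suc n * (n C suc k)               ≡⟨ +-assoc a _ _ ⟩
  a + (suc n * (n C k) + suc n * (n C suc k))               ≡⟨ cong (a +_) (*-distribˡ-+ (suc n) (n C k) (n C suc k)) ⟨
  a + suc n * (n C k + n C suc k)                           ≡⟨ cong (λ x → a + suc n * x) (nCk+nC[k+1]≡[n+1]C[k+1] n k) ⟩
  suc (suc n) * a                                           ∎
  where
  open ≡-Reasoning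
  a = suc n C suc k
  b = suc n C suc (suc k)

1≤[t+d]Cd : ∀ t d → 1 ≤ (t + d) C d
1≤[t+d]Cd t zero    = ≤-refl
1≤[t+d]Cd t (suc d) rewrite +-suc t d = begin
  1                                   ≤⟨ 1≤[t+d]Cd t d ⟩
  (t + d) C d                         ≤⟨ m≤m+n _ _ ⟩
  (t + d) C d + (t + d) C suc d       ≡⟨ nCk+nC[k+1]≡[n+1]C[k+1] (t + d) d ⟩
  suc (t + d) C suc d                 ∎
  where open ≤-Reasoning

-- Passing from d to d + 1 multiplies the coefficient by (t + d + 1)/(d + 1), which is at most t +
-- 1.
[t+d]Cd≤[t+1]^d : ∀ t d → (t + d) C d ≤ suc t ^ d
[t+d]Cd≤[t+1]^d t zero    = ≤-refl
[t+d]Cd≤[t+1]^d t (suc d) rewrite +-suc t d = *-cancelˡ-≤ (suc d) (begin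
  suc d * (suc (t + d) C suc d) ≡⟨ [k+1]*[n+1]C[k+1]≡[n+1]*nCk (t + d) d ⟩
  suc (t + d) * ((t + d) C d)   ≤⟨ *-mono-≤ t+d+1≤ ([t+d]Cd≤[t+1]^d t d) ⟩
  (suc d * suc t) * suc t ^ d   ≡⟨ *-assoc (suc d) (suc t) _ ⟩
  suc d * suc t ^ suc d         ∎)
  where
  open ≤-Reasoning
  t+d+1≤ : suc (t + d) ≤ suc d * suc t
  t+d+1≤ = s≤s (+-monoʳ-≤ t (m≤m*n d (suc t)))

[t+d]Ct≡[t+d]Cd : ∀ t d → (t + d) C t ≡ (t + d) C d
[t+d]Ct≡[t+d]Cd t d = trans (nCk≡nC[n∸k] (m≤m+n t d)) (cong ((t + d) C_) (m+n∸m≡n t d))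

*-^-distrib : ∀ a b d → (a * b) ^ d ≡ a ^ d * b ^ d
*-^-distrib a b zero    = refl
*-^-distrib a b (suc d) = trans (cong (a * b *_) (*-^-distrib a b d)) (rearrange a b (a ^ d) (b ^ d))
  where
  rearrange : ∀ a b x y → (a * b) * (x * y) ≡ (a * x) * (b * y)
  rearrange = solve-∀

-- Each step down the diagonal divides the coefficient by at least m.
m^d*[v∸d]C[r∸d]≤vCr : ∀ m v r d .{{_ : NonZero m}} → m * r ≤ v → d ≤ r → m ^ d * ((v ∸ d) C (r ∸ d)) ≤ v C r
m^d*[v∸d]C[r∸d]≤vCr m v r zero mr≤v _ = ≤-reflexive (*-identityˡ _)
m^d*[v∸d]C[r∸d]≤vCr m@(suc m′) (suc v) (suc r) (suc d) mr≤v (s≤s d≤r) = *-cancelˡ-≤ (suc r) (begin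
  suc r * ((m * m ^ d) * c)     ≡⟨ rearrange (suc r) m (m ^ d) c ⟩
  (m * suc r) * (m ^ d * c)     ≤⟨ *-mono-≤ mr≤v (m^d*[v∸d]C[r∸d]≤vCr m v r d m*r≤v d≤r) ⟩
  suc v * (v C r)               ≡⟨ [k+1]*[n+1]C[k+1]≡[n+1]*nCk v r ⟨
  suc r * (suc v C suc r)       ∎)
  where
  open ≤-Reasoning
  c = (v ∸ d) C (r ∸ d)
  rearrange : ∀ a b x y → a * ((b * x) * y) ≡ (b * a) * (x * y)
  rearrange = solve-∀
  m*r≤v : m * r ≤ v
  m*r≤v = ≤-pred (≤-trans (≤-trans (s≤s (m≤n+m (m * r) m′)) (≤-reflexive (sym (*-suc m r)))) mr≤v)
m^d*[v∸d]C[r∸d]≤vCr m@(suc _) zero (suc r) (suc d) mr≤v _ = contradiction (≤-trans (≤-reflexive (sym (*-suc m r))) mr≤v) λ ()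

r+1≤2^r : ∀ r → suc r ≤ 2 ^ r
r+1≤2^r zero    = ≤-refl
r+1≤2^r (suc r) = begin
  suc (suc r)     ≤⟨ s≤s (m≤n+m (suc r) r) ⟩
  suc r + suc r   ≤⟨ +-mono-≤ (r+1≤2^r r) (r+1≤2^r r) ⟩
  2 ^ r + 2 ^ r   ≡⟨ cong (2 ^ r +_) (+-identityʳ _) ⟨
  2 ^ suc r       ∎
  where open ≤-Reasoning

-- The ratio (r + 3)/(r + 1) of consecutive left sides is at most 2 once r ≥ 1. Equality at r = 1
-- fixes the constant 3.
[r+1][r+2]≤3*2^r : ∀ r → suc r * suc (suc r) ≤ 3 * 2 ^ r
[r+1][r+2]≤3*2^r 0 = m≤m+n 2 1
[r+1][r+2]≤3*2^r 1 = ≤-refl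
[r+1][r+2]≤3*2^r (suc (suc r)) = begin
  suc (suc (suc r)) * suc (suc (suc (suc r)))     ≤⟨ m≤m+n _ (r * suc (suc (suc r))) ⟩
  _ ≡⟨ rearrange r ⟩
  2 * (suc (suc r) * suc (suc (suc r)))           ≤⟨ *-monoʳ-≤ 2 ([r+1][r+2]≤3*2^r (suc r)) ⟩
  2 * (3 * 2 ^ suc r)                             ≡⟨ swap 2 3 (2 ^ suc r) ⟩
  3 * 2 ^ suc (suc r)                             ∎
  where
  open ≤-Reasoning
  rearrange : ∀ r → suc (suc (suc r)) * suc (suc (suc (suc r))) + r * suc (suc (suc r)) ≡ 2 * (suc (suc r) * suc (suc (suc r)))
  rearrange = solve-∀
  swap : ∀ a b c → a * (b * c) ≡ b * (a * c)
  swap = solve-∀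

-- Numerical consequences of the lower bound on n.

-- The parameters are v = n ∸ t, r = k ∸ t = suc r′, q = r + 1 and p = (t + 1) q; the binomial coefficient
-- N d counts the k-sets containing a given (t + d)-set.
module Parameters (v r′ t s : ℕ) (1≤t : 1 ≤ t) (1≤s : 1 ≤ s) (large : suc t * (2 * (suc (suc r′) * suc (suc r′)) + 7 * s) ≤ t + v) where

  r q p : ℕ
  r = suc r′
  q = suc r
  p = suc t * q

  N : ℕ → ℕ
  N d = (v ∸ d) C (r ∸ d)

  Q : ℕ → ℕ
  Q d = p ^ d * (s + N d)

  open ≤-Reasoning

  private
    -- Since q = r + 1, 2(t + 1)q² = 2pr + 2p, and the surplus 2p pays for the t in n = t + v.
    v-large : 7 * (suc t * s) + 2 * p * r ≤ v
    v-large = +-cancelˡ-≤ t _ _ (begin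
      t + (7 * (suc t * s) + 2 * p * r)       ≤⟨ m≤m+n _ (3 * t + 4 + 2 * suc t * r′) ⟩
      t + (7 * (suc t * s) + 2 * p * r) + (3 * t + 4 + 2 * suc t * r′) ≡⟨ rearrange t s r′ ⟩
      suc t * (2 * (q * q) + 7 * s)           ≤⟨ large ⟩
      t + v                                   ∎)
      where
      rearrange : ∀ t s r′ →
        t + (7 * (suc t * s) + 2 * (suc t * suc (suc r′)) * suc r′) + (3 * t + 4 + 2 * suc t * r′)
        ≡ suc t * (2 * (suc (suc r′) * suc (suc r′)) + 7 * s)
      rearrange = solve-∀

    instance
      p≢0 : NonZero p
      p≢0 = _

      2p≢0 : NonZero (2 * p)
      2p≢0 = _

  2pr≤v : 2 * p * r ≤ v
  2pr≤v = m+n≤o⇒n≤o (7 * (suc t * s)) v-large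

  r≤v : r ≤ v
  r≤v = ≤-trans (m≤n*m r (2 * p)) 2pr≤v

  2p^d*N≤N : ∀ {d} → d ≤ r → (2 * p) ^ d * N d ≤ N 0
  2p^d*N≤N = m^d*[v∸d]C[r∸d]≤vCr (2 * p) v r _ 2pr≤v

  private
    absorb : ∀ w → r ≤ w → r * (w C r) ≡ w * ((w ∸ 1) C r′)
    absorb (suc w) _ = [k+1]*[n+1]C[k+1]≡[n+1]*nCk w r′

    -- One absorption step turns r · `N 0` into v times a coefficient: the factor v pays for 7(t +
    -- 1)s, and the r′ remaining diagonal steps pay for the power of 2p.
    s*2p^r′≤r*N : 7 * (suc t * s) * (2 * p) ^ r′ ≤ r * N 0
    s*2p^r′≤r*N = begin
      7 * (suc t * s) * (2 * p) ^ r′  ≤⟨ *-mono-≤ (m+n≤o⇒m≤o (7 * (suc t * s)) v-large) 2p^r′≤ ⟩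
      v * ((v ∸ 1) C r′)              ≡⟨ absorb v r≤v ⟨
      r * N 0                         ∎
      where
      2pr′≤ : 2 * p * r′ ≤ v ∸ 1
      2pr′≤ = begin
        2 * p * r′               ≡⟨ m+n∸m≡n 1 _ ⟨
        suc (2 * p * r′) ∸ 1     ≤⟨ ∸-monoˡ-≤ 1 (s≤s (m≤n+m (2 * p * r′) (2 * p ∸ 1))) ⟩
        2 * p + 2 * p * r′ ∸ 1   ≡⟨ cong (_∸ 1) (*-suc (2 * p) r′) ⟨
        2 * p * r ∸ 1            ≤⟨ ∸-monoˡ-≤ 1 2pr≤v ⟩
        v ∸ 1                    ∎
      2p^r′≤ : (2 * p) ^ r′ ≤ (v ∸ 1) C r′
      2p^r′≤ = begin
        (2 * p) ^ r′                                        ≡⟨ *-identityʳ _ ⟨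
        -- Descending all r′ steps leaves a choice of 0 elements, which counts 1.
        (2 * p) ^ r′ * 1                                    ≡⟨ cong (λ x → (2 * p) ^ r′ * ((v ∸ 1 ∸ r′) C x)) (n∸n≡0 r′) ⟨
        (2 * p) ^ r′ * ((v ∸ 1 ∸ r′) C (r′ ∸ r′))           ≤⟨ m^d*[v∸d]C[r∸d]≤vCr (2 * p) (v ∸ 1) r′ r′ 2pr′≤ ≤-refl ⟩
        (v ∸ 1) C r′                                        ∎

  -- One factor p = (t + 1)q is split off: t + 1 joins s, and r · q ≤ 3 · 2^r′ supplies the powers
  -- of 2 that turn the remaining p^r′ into (2p)^r′.
  7sp^d≤3N : ∀ {d} → d ≤ r → 7 * (s * p ^ d) ≤ 3 * N 0
  7sp^d≤3N {d} d≤r = *-cancelˡ-≤ r (begin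
    r * (7 * (s * p ^ d))                          ≤⟨ *-monoʳ-≤ r (*-monoʳ-≤ 7 (*-monoʳ-≤ s (^-monoʳ-≤ p d≤r))) ⟩
    r * (7 * (s * ((suc t * q) * p ^ r′)))         ≡⟨ rearrange₁ r s (suc t) q (p ^ r′) ⟩
    7 * (suc t * s) * ((r * q) * p ^ r′)           ≤⟨ *-monoʳ-≤ (7 * (suc t * s)) (*-monoˡ-≤ (p ^ r′) ([r+1][r+2]≤3*2^r r′)) ⟩
    7 * (suc t * s) * ((3 * 2 ^ r′) * p ^ r′)      ≡⟨ rearrange₂ (7 * (suc t * s)) 3 (2 ^ r′) (p ^ r′) ⟩
    3 * (7 * (suc t * s) * (2 ^ r′ * p ^ r′))      ≡⟨ cong (λ x → 3 * (7 * (suc t * s) * x)) (*-^-distrib 2 p r′) ⟨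
    3 * (7 * (suc t * s) * (2 * p) ^ r′)           ≤⟨ *-monoʳ-≤ 3 s*2p^r′≤r*N ⟩
    3 * (r * N 0)                                  ≡⟨ swap 3 r (N 0) ⟩
    r * (3 * N 0)                                  ∎)
    where
    rearrange₁ : ∀ r s t q x → r * (7 * (s * ((t * q) * x))) ≡ 7 * (t * s) * ((r * q) * x)
    rearrange₁ = solve-∀
    rearrange₂ : ∀ a b x y → a * ((b * x) * y) ≡ b * (a * (x * y))
    rearrange₂ = solve-∀
    swap : ∀ a b c → a * (b * c) ≡ b * (a * c)
    swap = solve-∀

  -- Here r ≤ 2^r′ ≤ (2p)^r′, and t ≥ 1 allows 14 = 7 · 2 to be replaced by 7(t + 1).
  14s≤N : 14 * s ≤ N 0
  14s≤N = *-cancelˡ-≤ r (begin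
    r * (14 * s)                     ≤⟨ *-monoˡ-≤ (14 * s) (r+1≤2^r r′) ⟩
    2 ^ r′ * (14 * s)                ≤⟨ *-monoˡ-≤ (14 * s) (^-monoˡ-≤ r′ (m≤m*n 2 p)) ⟩
    (2 * p) ^ r′ * (14 * s)          ≡⟨ rearrange ((2 * p) ^ r′) s ⟩
    7 * (2 * s) * (2 * p) ^ r′       ≤⟨ *-monoˡ-≤ ((2 * p) ^ r′) (*-monoʳ-≤ 7 (*-monoˡ-≤ s (s≤s 1≤t))) ⟩
    7 * (suc t * s) * (2 * p) ^ r′   ≤⟨ s*2p^r′≤r*N ⟩
    r * N 0                          ∎)
    where
    rearrange : ∀ x s → x * (14 * s) ≡ 7 * (2 * s) * x
    rearrange = solve-∀

  -- The two terms of `Q d` are at most 3/7 and 1/2 of `N 0`, and 3/7 + 1/2 = 13/14.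
  14Q≤13N : ∀ {d} → 1 ≤ d → d ≤ r → 14 * Q d ≤ 13 * N 0
  14Q≤13N {suc e} _ d≤r = begin
    14 * (p ^ d * (s + N d))                           ≡⟨ rearrange₁ (p ^ d) s (N d) ⟩
    2 * (7 * (s * p ^ d)) + 7 * (2 * (p ^ d * N d))    ≤⟨ +-mono-≤ (*-monoʳ-≤ 2 (7sp^d≤3N d≤r)) (*-monoʳ-≤ 7 2p^dN≤N) ⟩
    2 * (3 * N 0) + 7 * N 0                            ≡⟨ rearrange₂ (N 0) ⟩
    13 * N 0                                           ∎
    where
    d = suc e
    rearrange₁ : ∀ x s n → 14 * (x * (s + n)) ≡ 2 * (7 * (s * x)) + 7 * (2 * (x * n))
    rearrange₁ = solve-∀
    rearrange₂ : ∀ n → 2 * (3 * n) + 7 * n ≡ 13 * n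
    rearrange₂ = solve-∀
    2p^dN≤N : 2 * (p ^ d * N d) ≤ N 0
    2p^dN≤N = begin
      2 * (p ^ d * N d)                   ≡⟨ *-assoc 2 (p ^ d) (N d) ⟨
      -- Positivity of d enters here, through 2 ≤ 2^d.
      2 * p ^ d * N d                     ≤⟨ *-monoˡ-≤ (N d) (*-monoˡ-≤ (p ^ d) (m≤m*n 2 (2 ^ e) {{m^n≢0 2 e}})) ⟩
      2 ^ d * p ^ d * N d                 ≡⟨ cong (_* N d) (*-^-distrib 2 p d) ⟨
      (2 * p) ^ d * N d                   ≤⟨ 2p^d*N≤N d≤r ⟩
      N 0                                 ∎

  14Q0≤15N : 14 * Q 0 ≤ 15 * N 0
  14Q0≤15N = begin
    14 * (1 * (s + N 0))    ≡⟨ rearrange s (N 0) ⟩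
    14 * s + 14 * N 0       ≤⟨ +-monoˡ-≤ (14 * N 0) 14s≤N ⟩
    15 * N 0                ∎
    where
    rearrange : ∀ s n → 14 * (1 * (s + n)) ≡ 14 * s + 14 * n
    rearrange = solve-∀

  14Q≤15N : ∀ {d} → d ≤ r → 14 * Q d ≤ 15 * N 0
  14Q≤15N {zero}  _   = 14Q0≤15N
  14Q≤15N {suc d} d≤r = ≤-trans (14Q≤13N (s≤s z≤n) d≤r) (*-monoˡ-≤ (N 0) (m≤m+n 13 2))

  1≤N : 1 ≤ N 0
  1≤N = ≤-trans (≤-trans 1≤s (m≤n*m s 14)) 14s≤N

  4qN1≤N : 4 * (q * N 1) ≤ N 0
  4qN1≤N = begin
    4 * (q * N 1)                 ≡⟨ rearrange₁ q (N 1) ⟩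
    2 * (2 * q) * N 1             ≤⟨ *-monoˡ-≤ (N 1) (*-monoʳ-≤ 2 (*-monoˡ-≤ q (s≤s 1≤t))) ⟩
    2 * p * N 1                   ≡⟨ cong (_* N 1) (*-identityʳ (2 * p)) ⟨
    (2 * p) ^ 1 * N 1             ≤⟨ 2p^d*N≤N (s≤s z≤n) ⟩
    N 0                           ∎
    where
    rearrange₁ : ∀ x y → 4 * (x * y) ≡ 2 * (2 * x) * y
    rearrange₁ = solve-∀

  28[2s+qN1]≤11N : 28 * (s + (s + q * N 1)) ≤ 11 * N 0
  28[2s+qN1]≤11N = begin
    28 * (s + (s + q * N 1))                ≡⟨ rearrange s (q * N 1) ⟩
    4 * (14 * s) + 7 * (4 * (q * N 1))      ≤⟨ +-mono-≤ (*-monoʳ-≤ 4 14s≤N) (*-monoʳ-≤ 7 4qN1≤N) ⟩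
    4 * N 0 + 7 * N 0                       ≡⟨ *-distribʳ-+ (N 0) 4 7 ⟨
    11 * N 0                                ∎
    where
    rearrange : ∀ s x → 28 * (s + (s + x)) ≡ 4 * (14 * s) + 7 * (4 * x)
    rearrange = solve-∀

  s+N1<N : s + N 1 < N 0
  s+N1<N = *-cancelˡ-< 28 _ _ (begin-strict
    28 * (s + N 1)                ≤⟨ *-monoʳ-≤ 28 (+-monoʳ-≤ s (≤-trans (m≤n*m (N 1) q) (m≤n+m _ s))) ⟩
    28 * (s + (s + q * N 1))      ≤⟨ 28[2s+qN1]≤11N ⟩
    11 * N 0                      <⟨ *-monoˡ-< (N 0) {{>-nonZero 1≤N}} (m≤m+n 12 16) ⟩
    28 * N 0                      ∎)

-- The hypotheses say a ≤ (y/x)N and b ≤ (y′/x′)N with (y/x)(y′/x′) < 1; cross-multiplying avoids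
-- fractions.
product-small : ∀ {a b N} x x′ y y′ → 1 ≤ N → x * a ≤ y * N → x′ * b ≤ y′ * N → y * y′ < x * x′ → N * N ≤ a * b → ⊥
product-small {a} {b} {N} x x′ y y′ 1≤N xa≤ x′b≤ yy′< NN≤ = <-irrefl refl (begin-strict
  (y * y′) * (N * N)     <⟨ *-monoˡ-< (N * N) {{>-nonZero (*-mono-≤ 1≤N 1≤N)}} yy′< ⟩
  (x * x′) * (N * N)     ≤⟨ *-monoʳ-≤ (x * x′) NN≤ ⟩
  (x * x′) * (a * b)     ≡⟨ [m*n]*[o*p]≡[m*o]*[n*p] x x′ a b ⟩
  (x * a) * (x′ * b)     ≤⟨ *-mono-≤ xa≤ x′b≤ ⟩
  (y * N) * (y′ * N)     ≡⟨ [m*n]*[o*p]≡[m*o]*[n*p] y N y′ N ⟩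
  (y * y′) * (N * N)     ∎)
  where open ≤-Reasoning

-- Restriction of a family to supersets, and cardinalities of differences.

infixl 6 _[_]

_[_] : Family n → Subset n → Family n
(F [ U ]) A = F A ∧ ⌊ U ⊆? A ⌋

[]⁺ : (F : Family n) (U : Subset n) {A : Subset n} → F A ≡ true → U ⊆ A → (F [ U ]) A ≡ true
[]⁺ F U {A} FA U⊆A = ∧⁺ FA (⌊⌋⁺ (U ⊆? A) U⊆A)

[]⁻ : (F : Family n) (U : Subset n) {A : Subset n} → (F [ U ]) A ≡ true → F A ≡ true × U ⊆ A
[]⁻ F U {A} p = ∧-conicalˡ (F A) _ p , ⌊⌋⁻ (U ⊆? A) (∧-conicalʳ (F A) _ p)

∪-⊆ : {p q r : Subset n} → p ⊆ r → q ⊆ r → p ∪ q ⊆ r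
∪-⊆ {p = p} {q} p⊆r q⊆r = [ p⊆r , q⊆r ] ∘ x∈p∪q⁻ p q

∩-glb : {p q r : Subset n} → p ⊆ q → p ⊆ r → p ⊆ q ∩ r
∩-glb p⊆q p⊆r x∈p = x∈p∩q⁺ (p⊆q x∈p , p⊆r x∈p)

∣p─q∣≤ : {p p′ : Subset n} (q : Subset n) → p ⊆ p′ → ∣ p ─ q ∣ ≤ ∣ p′ ─ q ∣
∣p─q∣≤ {p = []}          {[]}     []            _    = z≤n
∣p─q∣≤ {p = outside ∷ p} {x ∷ p′} (inside ∷ q)  p⊆p′ = ∣p─q∣≤ q (drop-∷-⊆ p⊆p′)
∣p─q∣≤ {p = inside ∷ p}  {x ∷ p′} (inside ∷ q)  p⊆p′ = ∣p─q∣≤ q (drop-∷-⊆ p⊆p′)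
∣p─q∣≤ {p = outside ∷ p} {x ∷ p′} (outside ∷ q) p⊆p′ = ≤-trans (∣p─q∣≤ q (drop-∷-⊆ p⊆p′)) (∣p∣≤∣x∷p∣ x (p′ ─ q))
∣p─q∣≤ {p = inside ∷ p}  {outside ∷ p′} (outside ∷ q) p⊆p′ = contradiction (p⊆p′ Vec.here) λ ()
∣p─q∣≤ {p = inside ∷ p}  {inside ∷ p′}  (outside ∷ q) p⊆p′ = s≤s (∣p─q∣≤ q (drop-∷-⊆ p⊆p′))

X⊆p─q⇒∣q∪X∣≡∣q∣+∣X∣ : {X : Subset n} (p q : Subset n) → X ⊆ p ─ q → ∣ q ∪ X ∣ ≡ ∣ q ∣ + ∣ X ∣
X⊆p─q⇒∣q∪X∣≡∣q∣+∣X∣ {X = []} [] [] _ = refl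
X⊆p─q⇒∣q∪X∣≡∣q∣+∣X∣ {X = outside ∷ X} (_ ∷ p) (outside ∷ q) X⊆ = X⊆p─q⇒∣q∪X∣≡∣q∣+∣X∣ p q (drop-∷-⊆ X⊆)
X⊆p─q⇒∣q∪X∣≡∣q∣+∣X∣ {X = outside ∷ X} (_ ∷ p) (inside ∷ q)  X⊆ = cong suc (X⊆p─q⇒∣q∪X∣≡∣q∣+∣X∣ p q (drop-∷-⊆ X⊆))
X⊆p─q⇒∣q∪X∣≡∣q∣+∣X∣ {X = inside ∷ X}  (_ ∷ p) (outside ∷ q) X⊆ = trans (cong suc (X⊆p─q⇒∣q∪X∣≡∣q∣+∣X∣ p q (drop-∷-⊆ X⊆))) (sym (+-suc ∣ q ∣ ∣ X ∣))
X⊆p─q⇒∣q∪X∣≡∣q∣+∣X∣ {X = inside ∷ X}  (_ ∷ p) (inside ∷ q)  X⊆ = contradiction (X⊆ Vec.here) λ ()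

-- Branching over the elements of a member or of an almost-cover.

-- All but at most s members t-meet `B`, hence contain a j-subset of `D`; a union bound over these
-- subsets finishes. It serves twice: with j = 1 and `D` inside `B ─ U`, and with j = t and `B`, `D`
-- the same almost-cover.
branch : (F : Family n) (B D : Subset n) (t j s b : ℕ) →
  numTDisjoint t F B ≤ s →
  (∀ A → F A ≡ true → t ≤ ∣ B ∩ A ∣ → j ≤ ∣ D ∩ A ∣) →
  (∀ X → ∣ X ∣ ≡ j → X ⊆ D → size (F [ X ]) ≤ b) →
  size F ≤ s + (∣ D ∣ C j) * b
branch {n} F B D t j s b few meets bound = begin
  size F                        ≤⟨ size-∪ F _ rest split ⟩
  numTDisjoint t F B + size rest ≤⟨ +-mono-≤ few (size-⋃-family (below j D) rest (F [_]) b cover bound′) ⟩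
  s + size (below j D) * b      ≡⟨ cong (λ x → s + x * b) (size-below j D) ⟩
  s + (∣ D ∣ C j) * b           ∎
  where
  open ≤-Reasoning
  rest : Family n
  rest A = F A ∧ ⌊ j ≤? ∣ D ∩ A ∣ ⌋
  split : ∀ A → F A ≡ true → F A ∧ tDisjointᵇ t B A ≡ true ⊎ rest A ≡ true
  split A FA with ∣ B ∩ A ∣ <? t in eq
  ... | yes _ = inj₁ (∧⁺ FA refl)
  ... | no ≮t = inj₂ (∧⁺ FA (⌊⌋⁺ (j ≤? _) (meets A FA (≮⇒≥ ≮t))))
  cover : ∀ A → rest A ≡ true → ∃[ X ] (below j D X ≡ true × (F [ X ]) A ≡ true)
  cover A restA = X , ⌊⌋⁺ (below? j D X) (∣X∣≡j , ⊆-trans X⊆ (p∩q⊆p D A)) , []⁺ F X (∧-conicalˡ (F A) _ restA) (⊆-trans X⊆ (p∩q⊆q D A))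
    where
    sub = ⊆-ofSize j (D ∩ A) (⌊⌋⁻ (j ≤? _) (∧-conicalʳ (F A) _ restA))
    X = proj₁ sub
    ∣X∣≡j = proj₁ (proj₂ sub)
    X⊆ : X ⊆ D ∩ A
    X⊆ = proj₂ (proj₂ sub)
  bound′ : ∀ X → below j D X ≡ true → size (F [ X ]) ≤ b
  bound′ X KX = let c , X⊆D = ⌊⌋⁻ (below? j D X) KX in bound X c X⊆D

-- A set that t-meets B misses at most r of its t + r elements, hence meets every (r + 1)-subset of B ─ U.
extend : (F : Family n) (U B : Subset n) (t r s b : ℕ) →
  ∣ B ∣ ≡ t + r → numTDisjoint t F B ≤ s → ∣ U ∩ B ∣ < t →
  (∀ X → ∣ X ∣ ≡ suc ∣ U ∣ → U ⊆ X → size (F [ X ]) ≤ b) →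
  size (F [ U ]) ≤ s + suc r * b
extend {n} F U B t r s b ∣B∣ few U∩B<t bound = begin
  size (F [ U ])            ≤⟨ branch (F [ U ]) B D t 1 s b few′ meets bound′ ⟩
  s + (∣ D ∣ C 1) * b       ≡⟨ cong (λ x → s + x * b) (trans (nC1≡n ∣ D ∣) ∣D∣) ⟩
  s + suc r * b             ∎
  where
  open ≤-Reasoning
  -- Fewer than t of the t + r elements of `B` lie in `U`.
  r<∣B─U∣ : suc r ≤ ∣ B ─ U ∣
  r<∣B─U∣ = +-cancelˡ-≤ ∣ B ∩ U ∣ _ _ (begin
    ∣ B ∩ U ∣ + suc r       ≡⟨ +-suc ∣ B ∩ U ∣ r ⟩
    suc ∣ B ∩ U ∣ + r       ≡⟨ cong (λ x → suc ∣ x ∣ + r) (∩-comm B U) ⟩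
    suc ∣ U ∩ B ∣ + r       ≤⟨ +-monoˡ-≤ r U∩B<t ⟩
    t + r                   ≡⟨ trans (∣p∩q∣+∣p─q∣≡∣p∣ B U) ∣B∣ ⟨
    ∣ B ∩ U ∣ + ∣ B ─ U ∣   ∎)
  sub = ⊆-ofSize (suc r) (B ─ U) r<∣B─U∣
  D = proj₁ sub
  ∣D∣ = proj₁ (proj₂ sub)
  D⊆B─U : D ⊆ B ─ U
  D⊆B─U = proj₂ (proj₂ sub)
  few′ : numTDisjoint t (F [ U ]) B ≤ s
  few′ = ≤-trans (size-mono _ _ λ A p → let q = ∧-conicalˡ ((F [ U ]) A) _ p in
    ∧⁺ (proj₁ ([]⁻ F U q)) (∧-conicalʳ ((F [ U ]) A) _ p)) few
  meets : ∀ A → (F [ U ]) A ≡ true → t ≤ ∣ B ∩ A ∣ → 1 ≤ ∣ D ∩ A ∣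
  meets A _ t≤ = +-cancelʳ-≤ ∣ D ─ A ∣ 1 (∣ D ∩ A ∣) (begin
    suc ∣ D ─ A ∣           ≤⟨ s≤s (∣p─q∣≤ A (⊆-trans D⊆B─U (p─q⊆p B U))) ⟩
    suc ∣ B ─ A ∣           ≤⟨ s≤s (+-cancelˡ-≤ t _ _ (begin
      t + ∣ B ─ A ∣              ≤⟨ +-monoˡ-≤ ∣ B ─ A ∣ t≤ ⟩
      ∣ B ∩ A ∣ + ∣ B ─ A ∣      ≡⟨ trans (∣p∩q∣+∣p─q∣≡∣p∣ B A) ∣B∣ ⟩
      t + r                      ∎)) ⟩
    suc r                   ≡⟨ trans (∣p∩q∣+∣p─q∣≡∣p∣ D A) ∣D∣ ⟨
    ∣ D ∩ A ∣ + ∣ D ─ A ∣   ∎)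
  bound′ : ∀ X → ∣ X ∣ ≡ 1 → X ⊆ D → size (F [ U ] [ X ]) ≤ b
  bound′ X ∣X∣ X⊆D = ≤-trans
    (size-mono (F [ U ] [ X ]) (F [ U ∪ X ]) λ A p → let FUA , X⊆A = []⁻ (F [ U ]) X p ; FA , U⊆A = []⁻ F U FUA in []⁺ F (U ∪ X) FA (∪-⊆ U⊆A X⊆A))
    (bound (U ∪ X) (trans (X⊆p─q⇒∣q∪X∣≡∣q∣+∣X∣ B U (⊆-trans X⊆D D⊆B─U)) (trans (cong (∣ U ∣ +_) ∣X∣) (+-comm ∣ U ∣ 1))) (p⊆p∪q X))

tDisjoint-member : (G : Family n) (U : Subset n) (t s : ℕ) → s < numTDisjoint t G U → ∃[ B ] (G B ≡ true × ∣ U ∩ B ∣ < t)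
tDisjoint-member G U t s s< = let B , p = size-positive _ (≤-<-trans z≤n s<) in
  B , ∧-conicalˡ (G B) _ p , ⌊⌋⁻ (_ <? t) (∧-conicalʳ (G B) _ p)

-- Adding s to the size makes the recursion multiplicative: x ≤ s + qy gives s + x ≤ q(s + y),
-- because 2s ≤ qs when r ≥ 1. Each of the e steps adds one element and costs a factor q.
expand : (F G : Family n) (t r s M e : ℕ) → 1 ≤ r → InLayer (t + r) G →
  (∀ B → G B ≡ true → numTDisjoint t F B ≤ s) →
  (U : Subset n) →
  (∀ X → ∣ U ∣ ≤ ∣ X ∣ → ∣ X ∣ < ∣ U ∣ + e → s < numTDisjoint t G X) →
  (∀ X → ∣ X ∣ ≡ ∣ U ∣ + e → size (F [ X ]) ≤ M) →
  s + size (F [ U ]) ≤ suc r ^ e * (s + M)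
expand F G t r s M zero 1≤r layer few U noCover top =
  ≤-trans (+-monoʳ-≤ s (top U (sym (+-identityʳ ∣ U ∣)))) (≤-reflexive (sym (*-identityˡ (s + M))))
expand F G t r s M (suc e) 1≤r layer few U noCover top = begin
  s + size (F [ U ])          ≤⟨ +-monoʳ-≤ s (extend F U B t r s (c ∸ s) (layer B GB) (few B GB) U∩B<t bound) ⟩
  s + (s + q * (c ∸ s))       ≡⟨ rearrange s (q * (c ∸ s)) ⟩
  2 * s + q * (c ∸ s)         ≤⟨ +-monoˡ-≤ _ (*-monoˡ-≤ s (s≤s 1≤r)) ⟩
  q * s + q * (c ∸ s)         ≡⟨ *-distribˡ-+ q s (c ∸ s) ⟨
  q * (s + (c ∸ s))           ≡⟨ cong (q *_) (m+[n∸m]≡n s≤c) ⟩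
  q * c                       ≡⟨ *-assoc q (q ^ e) (s + M) ⟨
  q ^ suc e * (s + M)         ∎
  where
  open ≤-Reasoning
  q = suc r
  c = q ^ e * (s + M)
  -- The size of `U` lies in the range of `noCover`, so `U` itself is not an almost-cover of `G`.
  member = tDisjoint-member G U t s (noCover U ≤-refl (m<m+n ∣ U ∣ (s≤s z≤n)))
  B = proj₁ member
  GB = proj₁ (proj₂ member)
  U∩B<t = proj₂ (proj₂ member)
  rearrange : ∀ s x → s + (s + x) ≡ 2 * s + x
  rearrange = solve-∀
  -- Makes the truncated difference `c ∸ s` exact.
  s≤c : s ≤ c
  s≤c = ≤-trans (m≤m+n s M) (m≤n*m (s + M) (q ^ e) {{m^n≢0 q e}})
  shift : ∀ {X} → ∣ X ∣ ≡ suc ∣ U ∣ → ∣ X ∣ + e ≡ ∣ U ∣ + suc e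
  shift eq = trans (cong (_+ e) eq) (sym (+-suc ∣ U ∣ e))
  bound : ∀ X → ∣ X ∣ ≡ suc ∣ U ∣ → U ⊆ X → size (F [ X ]) ≤ c ∸ s
  bound X ∣X∣ _ = m+n≤o⇒m≤o∸n _ (subst (_≤ c) (+-comm s _) (expand F G t r s M e 1≤r layer few X
    (λ Y X≤Y Y< → noCover Y (≤-trans (subst (∣ U ∣ ≤_) (sym ∣X∣) (n≤1+n ∣ U ∣)) X≤Y) (subst (∣ Y ∣ <_) (shift {X} ∣X∣) Y<))
    (λ Y ∣Y∣ → top Y (trans ∣Y∣ (shift {X} ∣X∣)))))

-- A member that t-meets `S` lies above one of the `K` t-subsets of `S`, each carrying at most
-- `c ∸ s` members. As `K` is positive, the s exceptional members are absorbed into `K * s`.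
size-bound : (F : Family n) (S : Subset n) (t d s c : ℕ) → ∣ S ∣ ≡ t + d →
  numTDisjoint t F S ≤ s → s ≤ c →
  (∀ U → ∣ U ∣ ≡ t → s + size (F [ U ]) ≤ c) →
  size F ≤ suc t ^ d * c
size-bound F S t d s c ∣S∣ few s≤c bound = begin
  size F                        ≤⟨ branch F S S t t s (c ∸ s) few (λ _ _ → id) (λ U ∣U∣ _ → m+n≤o⇒m≤o∸n _ (subst (_≤ c) (+-comm s _) (bound U ∣U∣))) ⟩
  s + (∣ S ∣ C t) * (c ∸ s)     ≡⟨ cong (λ x → s + x * (c ∸ s)) (trans (cong (_C t) ∣S∣) ([t+d]Ct≡[t+d]Cd t d)) ⟩
  s + K * (c ∸ s)               ≤⟨ +-monoˡ-≤ _ (m≤n*m s K {{>-nonZero (1≤[t+d]Cd t d)}}) ⟩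
  K * s + K * (c ∸ s)           ≡⟨ *-distribˡ-+ K s (c ∸ s) ⟨
  K * (s + (c ∸ s))             ≡⟨ cong (K *_) (m+[n∸m]≡n s≤c) ⟩
  K * c                         ≤⟨ *-monoˡ-≤ c ([t+d]Cd≤[t+1]^d t d) ⟩
  suc t ^ d * c                 ∎
  where
  open ≤-Reasoning
  K = (t + d) C d

-- Containment from cardinalities, and least witnesses.

∣p∣≤∣p∩q∣⇒p⊆q : (p q : Subset n) → ∣ p ∣ ≤ ∣ p ∩ q ∣ → p ⊆ q
∣p∣≤∣p∩q∣⇒p⊆q p q p≤p∩q {x} x∈p with x ∈? q
... | yes x∈q = x∈q
... | no  x∉q = contradiction (≤-trans (≤-<-trans z≤n (x∈p⇒∣p-x∣<∣p∣ (x∈p∧x∉q⇒x∈p─q x∈p x∉q))) p─q≤0) λ ()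
  where
  p─q≤0 : ∣ p ─ q ∣ ≤ 0
  p─q≤0 = +-cancelˡ-≤ ∣ p ∩ q ∣ _ _ (≤-trans (≤-reflexive (∣p∩q∣+∣p─q∣≡∣p∣ p q)) (≤-trans p≤p∩q (≤-reflexive (sym (+-identityʳ _)))))

⊆∧∣q∣≤∣p∣⇒⊇ : (p q : Subset n) → p ⊆ q → ∣ q ∣ ≤ ∣ p ∣ → q ⊆ p
⊆∧∣q∣≤∣p∣⇒⊇ p q p⊆q q≤p = ∣p∣≤∣p∩q∣⇒p⊆q q p (≤-trans q≤p (p⊆q⇒∣p∣≤∣q∣ {p = p} {q = q ∩ p} (∩-glb {p = p} {q = q} {r = p} p⊆q id)))

least : ∀ {P : ℕ → Set} → (∀ d → Dec (P d)) → ∀ r → P r → ∃[ d ] (d ≤ r × P d × (∀ e → e < d → ¬ P e))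
least P? zero    Pr = 0 , z≤n , Pr , λ _ ()
least P? (suc r) Pr with P? 0
... | yes P0 = 0 , z≤n , P0 , λ _ ()
... | no ¬P0 = let d , d≤r , Pd , min = least (P? ∘ suc) r Pr in
  suc d , s≤s d≤r , Pd , λ { zero _ → ¬P0 ; (suc e) (s≤s e<d) → min e e<d }

-- For a set of exactly t elements, t-intersecting it means containing it.
size≤s+size[T] : (F : Family n) (T : Subset n) (t s : ℕ) → ∣ T ∣ ≡ t → numTDisjoint t F T ≤ s → size F ≤ s + size (F [ T ])
size≤s+size[T] F T t s ∣T∣ few = ≤-trans (size-∪ F _ (F [ T ]) split) (+-monoˡ-≤ _ few)
  where
  split : ∀ A → F A ≡ true → F A ∧ tDisjointᵇ t T A ≡ true ⊎ (F [ T ]) A ≡ true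
  split A FA with ∣ T ∩ A ∣ <? t
  ... | yes _ = inj₁ (∧⁺ FA refl)
  ... | no ≮t = inj₂ ([]⁺ F T FA (∣p∣≤∣p∩q∣⇒p⊆q T A (subst (_≤ ∣ T ∩ A ∣) (sym ∣T∣) (≮⇒≥ ≮t))))

-- Stars and least almost-covers of k-uniform families.

module Uniform (v r′ t s : ℕ) (1≤t : 1 ≤ t) (1≤s : 1 ≤ s)
  (large : suc t * (2 * (suc (suc r′) * suc (suc r′)) + 7 * s) ≤ t + v) where

  open Parameters v r′ t s 1≤t 1≤s large

  n₀ k : ℕ
  n₀ = t + v
  k = t + r

  size-star-N : ∀ {d} → d ≤ r → (X : Subset n₀) → ∣ X ∣ ≡ t + d → size (star k X) ≡ N d
  size-star-N {d} d≤r X ∣X∣ = trans (cong (λ x → size (star x X)) k≡) (size-star (v ∸ d) (r ∸ d) X n≡)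
    where
    k≡ : k ≡ ∣ X ∣ + (r ∸ d)
    k≡ = sym (trans (cong (_+ (r ∸ d)) ∣X∣) (trans (+-assoc t d _) (cong (t +_) (m+[n∸m]≡n d≤r))))
    n≡ : ∣ X ∣ + (v ∸ d) ≡ n₀
    n≡ = trans (cong (_+ (v ∸ d)) ∣X∣) (trans (+-assoc t d _) (cong (t +_) (m+[n∸m]≡n (≤-trans d≤r r≤v))))

  [X]⊑star : (F : Family n₀) → InLayer k F → ∀ X → F [ X ] ⊑ star k X
  [X]⊑star F layer X A p = let FA , X⊆A = []⁻ F X p in ⌊⌋⁺ (star? k X A) (layer A FA , X⊆A)

  size[X]≤N : ∀ {d} → d ≤ r → (F : Family n₀) → InLayer k F → ∀ X → ∣ X ∣ ≡ t + d → size (F [ X ]) ≤ N d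
  size[X]≤N d≤r F layer X ∣X∣ = ≤-trans (size-mono (F [ X ]) (star k X) ([X]⊑star F layer X)) (≤-reflexive (size-star-N d≤r X ∣X∣))

  -- Any two members share `W`, so no pair is t-disjoint.
  star-crossIntersecting : (W : Subset n₀) → ∣ W ∣ ≡ t → AlmostCrossIntersecting s t (star k W) (star k W)
  star-crossIntersecting W ∣W∣ = half , half
    where
    half : ∀ A → star k W A ≡ true → numTDisjoint t (star k W) A ≤ s
    half A A∈ = ≤-trans (≤-reflexive (size-∅ _ λ B p →
      let W⊆B = proj₂ (⌊⌋⁻ (star? k W B) (∧-conicalˡ (star k W B) _ p))
          A∩B<t = ⌊⌋⁻ (∣ A ∩ B ∣ <? t) (∧-conicalʳ (star k W B) _ p)
      in <⇒≱ A∩B<t (subst (_≤ ∣ A ∩ B ∣) ∣W∣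
           (p⊆q⇒∣p∣≤∣q∣ {p = W} {q = A ∩ B} (∩-glb {p = W} {q = A} {r = B} (proj₂ (⌊⌋⁻ (star? k W A) A∈)) W⊆B))))) z≤n

  AlmostCover : Family n₀ → ℕ → Subset n₀ → Set
  AlmostCover F d S = ∣ S ∣ ≡ t + d × numTDisjoint t F S ≤ s

  -- The least excess over t of the size of an almost-cover. Minimality is phrased over all sets of
  -- size in [t, t + d), as `expand` requires.
  IsCoverDefect : Family n₀ → ℕ → Set
  IsCoverDefect F d = ∃ (AlmostCover F d) × (∀ X → t ≤ ∣ X ∣ → ∣ X ∣ < t + d → s < numTDisjoint t F X)

  -- Any member of `G` almost covers `F` and has t + r elements, so the search for the least excess
  -- ends by r.
  coverDefect : (F G : Family n₀) → InLayer k G → (∀ B → G B ≡ true → numTDisjoint t F B ≤ s) → 0 < size G →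
    ∃[ d ] (d ≤ r × IsCoverDefect F d)
  coverDefect F G layer few 0<G =
    let B , GB = size-positive G 0<G
        d , d≤r , cover , min = least cover? r (B , layer B GB , few B GB)
    in d , d≤r , cover , λ X t≤X X<t+d → ≰⇒> λ few →
         min (∣ X ∣ ∸ t) (+-cancelˡ-< t _ _ (subst (_< t + d) (sym (m+[n∸m]≡n t≤X)) X<t+d)) (X , sym (m+[n∸m]≡n t≤X) , few)
    where
    cover? : ∀ d → Dec (∃ (AlmostCover F d))
    cover? d = anySubset? λ S → (∣ S ∣ ≟ t + d) ×-dec (numTDisjoint t F S ≤? s)

  -- A least almost-cover of `F` provides the starting t-sets; above each, the absence of smaller
  -- almost-covers of `G` allows e expansion steps.
  size≤ : (F G : Family n₀) → InLayer k F → InLayer k G → (∀ B → G B ≡ true → numTDisjoint t F B ≤ s) →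
    ∀ {d e} → IsCoverDefect F d → e ≤ r → IsCoverDefect G e → size F ≤ suc t ^ d * (q ^ e * (s + N e))
  size≤ F G layerF layerG few {d} {e} ((S , ∣S∣ , fewS) , _) e≤r (_ , noCover) =
    size-bound F S t d s (q ^ e * (s + N e)) ∣S∣ fewS
      (≤-trans (m≤m+n s (N e)) (m≤n*m (s + N e) (q ^ e) {{m^n≢0 q e}}))
      λ U ∣U∣ → expand F G t r s (N e) e (s≤s z≤n) layerG few U
        (λ X U≤X X<U+e → noCover X (subst (_≤ ∣ X ∣) ∣U∣ U≤X) (subst (λ u → ∣ X ∣ < u + e) ∣U∣ X<U+e))
        (λ X ∣X∣ → size[X]≤N e≤r F layerF X (trans ∣X∣ (cong (_+ e) ∣U∣)))

  -- From nearly extremal sizes to stars.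

  module NearExtremal (F G : Family n₀) (layerF : InLayer k F) (layerG : InLayer k G)
    (fewF : ∀ B → G B ≡ true → numTDisjoint t F B ≤ s)
    (NN≤ : N 0 * N 0 ≤ size F * size G) (size-G : 14 * size G ≤ 15 * N 0) where

    -- A member `B` of `G` that fails to contain `T` is t-disjoint with it, so branching on `B`
    -- above `T` leaves `F` at most 11/28 of `N 0`. The product is then too small, as 11 · 15 = 165
    -- < 392 = 28 · 14.
    ⊇cover : (T : Subset n₀) → AlmostCover F 0 T → ∀ B → G B ≡ true → T ⊆ B
    ⊇cover T (∣T∣ , fewT) B GB with T ⊆? B
    ... | yes T⊆B = T⊆B
    ... | no  T⊈B = contradiction NN≤ (product-small {size F} {size G} 28 14 11 15 1≤N
                      (≤-trans (*-monoʳ-≤ 28 small) 28[2s+qN1]≤11N) size-G (m≤m+n 166 226))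
      where
      ∣T∣≡t : ∣ T ∣ ≡ t
      ∣T∣≡t = trans ∣T∣ (+-identityʳ t)
      T∩B<t : ∣ T ∩ B ∣ < t
      T∩B<t = ≰⇒> λ t≤ → T⊈B (∣p∣≤∣p∩q∣⇒p⊆q T B (subst (_≤ ∣ T ∩ B ∣) (sym ∣T∣≡t) t≤))
      small : size F ≤ s + (s + q * N 1)
      small = ≤-trans (size≤s+size[T] F T t s ∣T∣≡t fewT) (+-monoʳ-≤ s
        (extend F T B t r s (N 1) (layerG B GB) (fewF B GB) T∩B<t
          λ X ∣X∣ _ → size[X]≤N (s≤s z≤n) F layerF X (trans ∣X∣ (trans (cong suc ∣T∣≡t) (+-comm 1 t)))))

  N≤factor : ∀ {a b} → N 0 * N 0 ≤ a * b → b ≤ N 0 → N 0 ≤ a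
  N≤factor {a} NN≤ab b≤N = *-cancelʳ-≤ (N 0) a (N 0) {{>-nonZero 1≤N}} (≤-trans NN≤ab (*-monoʳ-≤ a b≤N))

  module _ (F G : Family n₀) (layerF : InLayer k F) (layerG : InLayer k G)
    (fewG : ∀ A → F A ≡ true → numTDisjoint t G A ≤ s)
    (fewF : ∀ B → G B ≡ true → numTDisjoint t F B ≤ s)
    (NN≤ : N 0 * N 0 ≤ size F * size G) where

    private
      open ≤-Reasoning

      NN≤′ : N 0 * N 0 ≤ size G * size F
      NN≤′ = ≤-trans NN≤ (≤-reflexive (*-comm (size F) (size G)))

      0<FG : 0 < size F * size G
      0<FG = ≤-trans (*-mono-≤ 1≤N 1≤N) NN≤

    -- The bound on `F` pairs (t + 1)^d with q^e and the bound on `G` pairs (t + 1)^e with q^d; only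
    -- their product regroups into powers of p.
    product≤QQ : ∀ {d e} → d ≤ r → e ≤ r → IsCoverDefect F d → IsCoverDefect G e → size F * size G ≤ Q d * Q e
    product≤QQ {d} {e} d≤r e≤r dF eG = begin
      size F * size G
        ≤⟨ *-mono-≤ (size≤ F G layerF layerG fewF dF e≤r eG) (size≤ G F layerG layerF fewG eG d≤r dF) ⟩
      suc t ^ d * (q ^ e * (s + N e)) * (suc t ^ e * (q ^ d * (s + N d)))
        ≡⟨ rearrange (suc t ^ d) (q ^ e) (s + N e) (suc t ^ e) (q ^ d) (s + N d) ⟩
      (suc t ^ d * q ^ d) * (s + N d) * ((suc t ^ e * q ^ e) * (s + N e))
        ≡⟨ cong₂ (λ x y → x * (s + N d) * (y * (s + N e))) (*-^-distrib (suc t) q d) (*-^-distrib (suc t) q e) ⟨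
      Q d * Q e ∎
      where
      rearrange : ∀ a b x c y z → a * (b * x) * (c * (y * z)) ≡ (a * y) * z * ((c * b) * x)
      rearrange = solve-∀

    -- One positive defect already suffices for a contradiction: 13 · 15 = 195 < 196 = 14 · 14.
    defects≡0 : ∀ {d e} → d ≤ r → e ≤ r → IsCoverDefect F d → IsCoverDefect G e → d ≡ 0 × e ≡ 0
    defects≡0 {zero}  {zero}  _   _   _  _  = refl , refl
    defects≡0 {suc d} {e}     d≤r e≤r dF eG = contradiction (≤-trans NN≤ (product≤QQ d≤r e≤r dF eG))
      (product-small {Q (suc d)} {Q e} 14 14 13 15 1≤N (14Q≤13N (s≤s z≤n) d≤r) (14Q≤15N e≤r) ≤-refl)
    defects≡0 {zero}  {suc e} d≤r e≤r dF eG = contradiction (≤-trans NN≤ (product≤QQ d≤r e≤r dF eG))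
      (product-small {Q 0} {Q (suc e)} 14 14 15 13 1≤N (14Q≤15N d≤r) (14Q≤13N (s≤s z≤n) e≤r) ≤-refl)

    common-star : ∃[ W ] (∣ W ∣ ≡ t × (star k W ⊑ F × F ⊑ star k W) × (star k W ⊑ G × G ⊑ star k W))
    common-star = fromDefects (coverDefect F G layerG fewF 0<G) (coverDefect G F layerF fewG 0<F)
      where
      0<F : 0 < size F
      0<F = >-nonZero⁻¹ _ {{m*n≢0⇒m≢0 (size F) {{>-nonZero 0<FG}}}}
      0<G : 0 < size G
      0<G = >-nonZero⁻¹ _ {{m*n≢0⇒n≢0 (size F) {{>-nonZero 0<FG}}}}
      fromDefects : ∃[ d ] (d ≤ r × IsCoverDefect F d) → ∃[ e ] (e ≤ r × IsCoverDefect G e) →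
        ∃[ W ] (∣ W ∣ ≡ t × (star k W ⊑ F × F ⊑ star k W) × (star k W ⊑ G × G ⊑ star k W))
      fromDefects (d , d≤r , dF) (e , e≤r , eG) with defects≡0 d≤r e≤r dF eG
      ... | refl , refl = T₂ , ∣T₂∣≡t , (star⊑F , F⊑star) , (star⊑G , G⊑star)
        where
        T₁ = proj₁ (proj₁ dF)
        T₂ = proj₁ (proj₁ eG)
        cover₁ = proj₂ (proj₁ dF)
        cover₂ = proj₂ (proj₁ eG)
        ∣T₁∣≡t : ∣ T₁ ∣ ≡ t
        ∣T₁∣≡t = trans (proj₁ cover₁) (+-identityʳ t)
        ∣T₂∣≡t : ∣ T₂ ∣ ≡ t
        ∣T₂∣≡t = trans (proj₁ cover₂) (+-identityʳ t)
        size≤Q₀ : ∀ {x} → x ≤ 1 * (1 * (s + N 0)) → 14 * x ≤ 15 * N 0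
        size≤Q₀ x≤ = ≤-trans (*-monoʳ-≤ 14 (≤-trans x≤ (≤-reflexive (*-identityˡ _)))) (14Q≤15N z≤n)
        -- The roles cross: `T₁` almost covers `F` but is contained in the members of `G`.
        T₁⊆ : ∀ B → G B ≡ true → T₁ ⊆ B
        T₁⊆ = NearExtremal.⊇cover F G layerF layerG fewF NN≤ (size≤Q₀ (size≤ G F layerG layerF fewG eG z≤n dF)) T₁ cover₁
        T₂⊆ : ∀ A → F A ≡ true → T₂ ⊆ A
        T₂⊆ = NearExtremal.⊇cover G F layerG layerF fewG NN≤′ (size≤Q₀ (size≤ F G layerF layerG fewF dF z≤n eG)) T₂ cover₂
        F⊑star : F ⊑ star k T₂
        F⊑star A FA = ⌊⌋⁺ (star? k T₂ A) (layerF A FA , T₂⊆ A FA)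
        F≤N : size F ≤ N 0
        F≤N = ≤-trans (size-mono F (star k T₂) F⊑star) (≤-reflexive (size-star-N z≤n T₂ (proj₁ cover₂)))
        G⊑star₁ : G ⊑ star k T₁
        G⊑star₁ B GB = ⌊⌋⁺ (star? k T₁ B) (layerG B GB , T₁⊆ B GB)
        G≤N : size G ≤ N 0
        G≤N = ≤-trans (size-mono G (star k T₁) G⊑star₁) (≤-reflexive (size-star-N z≤n T₁ (proj₁ cover₁)))
        -- Both sizes are at most `N 0` while their product is at least its square, so both equal
        -- `N 0`.
        N≤F : N 0 ≤ size F
        N≤F = N≤factor NN≤ G≤N
        N≤G : N 0 ≤ size G
        N≤G = N≤factor NN≤′ F≤N
        star⊑F : star k T₂ ⊑ F
        star⊑F = size-≤⇒⊒ F (star k T₂) F⊑star (≤-trans (≤-reflexive (size-star-N z≤n T₂ (proj₁ cover₂))) N≤F)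
        -- Otherwise let `Y` be one element of `T₁ ─ T₂`. Every member of `F` contains `T₂`, so
        -- those above `T₁` contain the (t + 1)-set `T₂ ∪ Y`, leaving at most s + `N 1` members in
        -- `F`.
        T₁⊆T₂ : T₁ ⊆ T₂
        T₁⊆T₂ = ∣p∣≤∣p∩q∣⇒p⊆q T₁ T₂ (≮⇒≥ λ T₁∩T₂<T₁ →
          let Y , ∣Y∣ , Y⊆ = ⊆-ofSize 1 (T₁ ─ T₂) (+-cancelˡ-≤ ∣ T₁ ∩ T₂ ∣ _ _
                               (subst₂ _≤_ (+-comm 1 ∣ T₁ ∩ T₂ ∣) (sym (∣p∩q∣+∣p─q∣≡∣p∣ T₁ T₂)) T₁∩T₂<T₁))
              X = T₂ ∪ Y
              ∣X∣ : ∣ X ∣ ≡ t + 1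
              ∣X∣ = trans (X⊆p─q⇒∣q∪X∣≡∣q∣+∣X∣ T₁ T₂ Y⊆) (cong₂ _+_ ∣T₂∣≡t ∣Y∣)
              T₁⇒X : F [ T₁ ] ⊑ F [ X ]
              T₁⇒X A p = let FA , T₁⊆A = []⁻ F T₁ p in
                []⁺ F X FA (∪-⊆ {p = T₂} {q = Y} (T₂⊆ A FA) (⊆-trans {i = Y} {j = T₁} (⊆-trans {i = Y} {j = T₁ ─ T₂} Y⊆ (p─q⊆p T₁ T₂)) T₁⊆A))
          in <⇒≱ s+N1<N (≤-trans N≤F (≤-trans (size≤s+size[T] F T₁ t s ∣T₁∣≡t (proj₂ cover₁))
               (+-monoʳ-≤ s (≤-trans (size-mono (F [ T₁ ]) (F [ X ]) T₁⇒X) (size[X]≤N (s≤s z≤n) F layerF X ∣X∣))))))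
        T₁≡T₂ : T₁ ≡ T₂
        T₁≡T₂ = ⊆-antisym T₁⊆T₂ (⊆∧∣q∣≤∣p∣⇒⊇ T₁ T₂ T₁⊆T₂ (≤-reflexive (trans ∣T₂∣≡t (sym ∣T₁∣≡t))))
        G⊑star : G ⊑ star k T₂
        G⊑star = subst (λ T → G ⊑ star k T) T₁≡T₂ G⊑star₁
        star⊑G : star k T₂ ⊑ G
        star⊑G = size-≤⇒⊒ G (star k T₂) G⊑star (≤-trans (≤-reflexive (size-star-N z≤n T₂ (proj₁ cover₂))) N≤G)

  -- Maximality enters through a single competitor: the star of an arbitrary t-set, paired with
  -- itself, gives the lower bound `N 0 * N 0`.
  star-of-maximal : (F G : Family n₀) → InLayer k F → InLayer k G → AlmostCrossIntersecting s t F G →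
    (∀ F′ G′ → InLayer k F′ → InLayer k G′ → AlmostCrossIntersecting s t F′ G′ → size F′ * size G′ ≤ size F * size G) →
    ∃[ W ] (∣ W ∣ ≡ t ×
      (∀ H → (F H ≡ true ⇔ (∣ H ∣ ≡ k × W ⊆ H))) ×
      (∀ H → (G H ≡ true ⇔ (∣ H ∣ ≡ k × W ⊆ H))))
  star-of-maximal F G layerF layerG (fewG , fewF) maximal =
    let W , ∣W∣ , (star⊑F , F⊑star) , (star⊑G , G⊑star) = common-star F G layerF layerG fewG fewF NN≤
    in W , ∣W∣ , equivalence F W star⊑F F⊑star , equivalence G W star⊑G G⊑star
    where
    equivalence : ∀ F W → star k W ⊑ F → F ⊑ star k W → ∀ H → (F H ≡ true ⇔ (∣ H ∣ ≡ k × W ⊆ H))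
    equivalence F W star⊑F F⊑star H = mk⇔ (⌊⌋⁻ (star? k W H) ∘ F⊑star H) (star⊑F H ∘ ⌊⌋⁺ (star? k W H))
    W₀ = ⊆-ofSize {n₀} t ⊤ (subst (t ≤_) (sym (∣⊤∣≡n n₀)) (m≤m+n t v))
    W = proj₁ W₀
    ∣W∣ = proj₁ (proj₂ W₀)
    star-layer : InLayer k (star k W)
    star-layer A A∈ = proj₁ (⌊⌋⁻ (star? k W A) A∈)
    NN≤ : N 0 * N 0 ≤ size F * size G
    NN≤ = subst (λ x → x * x ≤ size F * size G) (size-star-N z≤n W (trans ∣W∣ (sym (+-identityʳ t))))
      (maximal (star k W) (star k W) star-layer star-layer (star-crossIntersecting W ∣W∣))

-- Translation to the original parameters.

t≤n : ∀ {t n s} x → 1 ≤ s → (t + 1) * (x + 7 * s) ≤ n → t ≤ n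
t≤n {t} {n} {s} x 1≤s n-large = begin
  t                         ≤⟨ m≤m+n t 1 ⟩
  t + 1                     ≤⟨ m≤m*n (t + 1) (x + 7 * s) {{>-nonZero (≤-trans (≤-trans 1≤s (m≤n*m s 7)) (m≤n+m (7 * s) x))}} ⟩
  (t + 1) * (x + 7 * s)     ≤⟨ n-large ⟩
  n                         ∎
  where open ≤-Reasoning

theorem1p1 : (n k t s : ℕ) → 1 ≤ n → 1 ≤ k → 1 ≤ t → 1 ≤ s →
    suc t ≤ k →
    (t + 1) * (2 * ((k ∸ t + 1) * (k ∸ t + 1)) + 7 * s) ≤ n →
    (F G : Family n) →
    InLayer k F → InLayer k G →
    AlmostCrossIntersecting s t F G →
    (∀ (F′ G′ : Family n) → InLayer k F′ → InLayer k G′ →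
    AlmostCrossIntersecting s t F′ G′ →
    size F′ * size G′ ≤ size F * size G) →
    ∃[ W ] (∣ W ∣ ≡ t ×
    (∀ (H : Subset n) → (F H ≡ true ⇔ (∣ H ∣ ≡ k × W ⊆ H))) ×
    (∀ (H : Subset n) → (G H ≡ true ⇔ (∣ H ∣ ≡ k × W ⊆ H))))
theorem1p1 n k t s 1≤n 1≤k 1≤t 1≤s t<k n-large
  -- Substitutes n = t + v and k = t + 1 + r′; the rewrites then bring k to `t + suc r′` and the
  -- lower bound on n to the form used in `Uniform`.
  with v , refl ← m≤n⇒∃[o]m+o≡n (t≤n {t} {n} {s} (2 * ((k ∸ t + 1) * (k ∸ t + 1))) 1≤s n-large)
  with r′ , refl ← m≤n⇒∃[o]m+o≡n t<k
  rewrite sym (+-suc t r′) | m+n∸m≡n t (suc r′) | +-comm t 1 | +-comm r′ 1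
  = Uniform.star-of-maximal v r′ t s 1≤t 1≤s n-large
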